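{- For every variable $x\in V$, every command $c\in\mathcal C$ and every reflexive relation $g\subseteq\Sigma\times\Sigma$ such that $g=\mathsf E_xg$, $$(\mathbf{var}\,x\cdot c)\Cap\mathbf{guar}\,g=(\mathbf{var}\,x\cdot c\Cap\mathbf{guar}\,g).$$
   Context: Commands. $(\mathcal C,\le,\bigwedge,\bigsqcup,\bot,\top)$ is a complete distributive lattice (with arbitrary meet $\bigwedge$, binary meet $\sqcap$, arbitrary join $\bigsqcup$ and binary join $\sqcup$) whose elements are called commands. It has an associative sequential composition $;$ with identity $\mathbf{nil}$, monotone in both arguments, and an associative, commutative, idempotent, monotone weak conjunction $\Cap$. Iterations: $c^0=\mathbf{nil}$, $c^{i+1}=c;c^i$; $c^\star$ (resp. $c^\omega$) is the least (resp. greatest) fixed point of $y\mapsto\mathbf{nil}\sqcup c;y$; $c^\infty=c^\omega;\bot$. One has $c^\star=\bigsqcup_{i\in\mathbb N}c^i$ and $c^\omega=c^\star\sqcup c^\infty$. States and relations. $V$ is a countable set of variables, $S$ a set, $\Sigma$ the set of partial functions $V\rightharpoonup S$. For $W\subseteq V$, $\mathrm{id}(W)$ relates $\sigma,\sigma'\in\Sigma$ iff they agree on every variable in $W$; $\mathrm{id}(x)=\mathrm{id}(\{x\})$, $\mathrm{id}(\overline x)=\mathrm{id}(V\setminus\{x\})$, and $\mathrm{id}$ is the identity relation on $\Sigma$. For $p\subseteq\Sigma$, $\mathsf E_x p$ is the image of $p$ under $\mathrm{id}(\overline x)$. For $r\subseteq\Sigma\times\Sigma$ (with $\circ$ denoting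 left-to-right relational composition), $\mathsf E^{\mathsf{first}}_x r=\mathrm{id}(\overline x)\circ r$, $\mathsf E^{\mathsf{last}}_x r=r\circ\mathrm{id}(\overline x)$, $\mathsf E_x r=\mathrm{id}(\overline x)\circ r\circ\mathrm{id}(\overline x)$. A relation $g$ is reflexive if $\mathrm{id}\subseteq g$. Primitive commands. $\tau:\mathcal P(\Sigma)\to\mathcal C$ (tests) and $\pi,\epsilon:\mathcal P(\Sigma\times\Sigma)\to\mathcal A$ (program and environment steps) are injective homomorphisms of complete Boolean algebras onto complete Boolean sub-algebras of $\mathcal C$ (joins, and nonempty meets, computed in $\mathcal C$; complement relative to the greatest element of the sub-algebra), with $\tau(\emptyset)=\pi(\emptyset)=\epsilon(\emptyset)=\bot$ and $\tau(\Sigma)=\mathbf{nil}$. $\mathcal A\subseteq\mathcal C$ is the complete Boolean sub-algebra of atomic steps, in which $\boldsymbol\pi=\pi(\Sigma\times\Sigma)$ and $\boldsymbol\epsilon=\epsilon(\Sigma\times\Sigma)$ are complementary; $\boldsymbol\alpha=\boldsymbol\pi\sqcup\boldsymbol\epsilon$. $\mathbf{chaos}=\boldsymbol\alpha^\omega$ is the identity of $\Cap$, and $a=a\Cap(\boldsymbol\alpha;\mathbf{chaos})$ for all $a\in\mathcal A$. Localisation. For each $x\in V$ there are unary operators $\mathsf E_x,\mathsf E^{\mathsf{first}}_x,\mathsf E^{\mathsf{last}}_x$ on $\mathcal C$ (binding tighter than binary operators). Each family $F\in\{\mathsf E,\mathsf E^{\mathsf{first}},\mathsf E^{\mathsf{last}}\}$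 satisfies $c\le F_xc$; $F_x(c\sqcap F_xd)=F_xc\sqcap F_xd$; $F_xF_yc=F_yF_xc$; $F_x(\bigsqcup C)=\bigsqcup_{c\in C}F_xc$. Further axioms: $\mathsf E^{\mathsf{first}}_xc\le\mathsf E_xc$; $\mathsf E^{\mathsf{last}}_xc\le\mathsf E_xc$; $\mathsf E_x\mathsf E^{\mathsf{first}}_yc=\mathsf E^{\mathsf{first}}_y\mathsf E_xc$; $\mathsf E_x\mathsf E^{\mathsf{last}}_yc=\mathsf E^{\mathsf{last}}_y\mathsf E_xc$; $\mathsf E^{\mathsf{first}}_x\mathsf E^{\mathsf{last}}_yc=\mathsf E^{\mathsf{last}}_y\mathsf E^{\mathsf{first}}_xc$; $\mathsf E_x\tau(p)=\mathsf E^{\mathsf{first}}_x\tau(p)=\mathsf E^{\mathsf{last}}_x\tau(p)=\tau(\mathsf E_xp)$; $F_x\pi(r)=\pi(F_xr)$ and $F_x\epsilon(r)=\epsilon(F_xr)$ for each of the three $F$; $\mathsf E_x(c;\mathsf E^{\mathsf{first}}_xd)=\mathsf E_xc;\mathsf E_xd=\mathsf E_x(\mathsf E^{\mathsf{last}}_xc;d)$; if $c=c\Cap(\boldsymbol\alpha;\mathbf{chaos})$ then $\mathsf E^{\mathsf{first}}_x(c;d)=\mathsf E^{\mathsf{first}}_xc;d$ and $\mathsf E^{\mathsf{last}}_x(d;c)=d;\mathsf E^{\mathsf{last}}_xc$; $\mathsf E_x(c\Cap\mathsf E_xd)=\mathsf E_xc\Cap\mathsf E_xd$; $\mathsf E^{\mathsf{first}}_x(c\Cap\mathsf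 E^{\mathsf{first}}_xd)=\mathsf E^{\mathsf{first}}_xc\Cap\mathsf E^{\mathsf{first}}_xd$; for $a\in\mathcal A$ with $\mathsf E_xa=\mathsf E^{\mathsf{last}}_xa$, $\mathsf E_x(a^\infty)=(\mathsf E_xa)^\infty$. Derived commands. $\mathbf{guar}\,g=(\pi(g)\sqcup\boldsymbol\epsilon)^\omega$; $\mathbf{demand}\,r=(\epsilon(r)\sqcup\boldsymbol\pi)^\omega$; $\mathbf{term}=\boldsymbol\alpha^\star;\boldsymbol\epsilon^\omega$; $\mathbf{idle}=\mathbf{term}\Cap\mathbf{guar}\,\mathrm{id}$. Known properties of the algebra: $\mathbf{guar}\,g_1\Cap\mathbf{guar}\,g_2=\mathbf{guar}(g_1\cap g_2)$; $\mathbf{guar}\,g\Cap(c;d)=(\mathbf{guar}\,g\Cap c);(\mathbf{guar}\,g\Cap d)$; $\mathbf{idle}=\mathbf{idle}\Cap\mathbf{guar}\,g$ if $g$ is reflexive. Local blocks. $(\mathbf{local}\,x\cdot c)=\mathsf E_x(\mathbf{demand}\,\mathrm{id}(x)\Cap c)\Cap\mathbf{guar}\,\mathrm{id}(x)$ and $(\mathbf{var}\,x\cdot c)=\mathbf{idle};(\mathbf{local}\,x\cdot c);\mathbf{idle}$. -}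

module Defs where

open import Algebra.Core using (Op₁; Op₂)
open import Algebra.Structures using (IsMonoid; IsIdempotentCommutativeMonoid)
open import Data.Maybe.Base using (Maybe)
open import Data.Nat.Base using (ℕ)
open import Data.Nat.GeneralisedArithmetic using (fold)
open import Data.Product.Base using (_×_; _,_; ∃; ∃-syntax; curry; proj₁; proj₂)
open import Function.Base using (_∘_)
open import Level using (Level; suc; Lift; lower)
open import Relation.Binary.Construct.Composition using () renaming (_;_ to _∘ᵣ_)
open import Relation.Binary.Construct.Intersection using (_∩_)
open import Relation.Binary.Core using (Rel; _⇒_; _Preserves₂_⟶_⟶_)
open import Relation.Binary.Definitions using (Maximum; Minimum)
open import Relation.Binary.Lattice.Structures using (IsDistributiveLattice)
open import Relation.Binary.PropositionalEquality.Core using (_≡_)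
open import Relation.Unary using (Pred; _∈_; _≐_; ∁; ｛_｝; ⋃; ⋂)
open import Relation.Unary.Polymorphic using (U; ∅)

-- Sets live in one fixed universe Set ℓ, and a subset of X is a Pred X ℓ,
-- subsets being equal when they have the same elements.

module States {ℓ} (V S : Set ℓ) where

  -- Partial functions from V to S.
  State : Set ℓ
  State = V → Maybe S

  -- The relation id(W): agreement (also as to definedness) on W.
  idOn : Pred V ℓ → Rel State ℓ
  idOn W σ σ′ = ∀ v → v ∈ W → σ v ≡ σ′ v

  -- The identity relation.  States are functions, so their equality is
  -- pointwise.
  idᵣ : Rel State ℓ
  idᵣ σ σ′ = ∀ v → σ v ≡ σ′ v

  idVar : V → Rel State ℓ
  idVar x = idOn ｛ x ｝

  idExcept : V → Rel State ℓ
  idExcept x = idOn (∁ ｛ x ｝)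

  IsReflexive : Pred (Rel State ℓ) ℓ
  IsReflexive g = idᵣ ⇒ g

  Eₛ : V → Pred State ℓ → Pred State ℓ
  Eₛ x p σ′ = ∃[ σ ] (σ ∈ p × idExcept x σ σ′)

  -- The library's composition of relations runs left to right.
  Eᵣ Eᵣfirst Eᵣlast : V → Rel State ℓ → Rel State ℓ
  Eᵣ      x r = idExcept x ∘ᵣ (r ∘ᵣ idExcept x)
  Eᵣfirst x r = idExcept x ∘ᵣ r
  Eᵣlast  x r = r ∘ᵣ idExcept x

-- Joins and meets are taken over families; the join of a subset C is that of
-- the family proj₁ : ∃ C → Carrier.

record CompleteDistributiveLattice (ℓ : Level) : Set (suc ℓ) where
  infix  4 _≈_ _≤_
  infixr 6 _⊔_
  infixr 7 _⊓_
  field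
    Carrier : Set ℓ
    _≈_ _≤_ : Rel Carrier ℓ
    _⊔_ _⊓_ : Op₂ Carrier
    ⊤ ⊥     : Carrier
    ⨆ ⨅     : {I : Set ℓ} → (I → Carrier) → Carrier

    isDistributiveLattice : IsDistributiveLattice _≈_ _≤_ _⊔_ _⊓_
    maximum : Maximum _≤_ ⊤
    minimum : Minimum _≤_ ⊥

    ⨆-upper    : {I : Set ℓ} (f : I → Carrier) → ∀ i → f i ≤ ⨆ f
    ⨆-least    : {I : Set ℓ} (f : I → Carrier) → ∀ c → (∀ i → f i ≤ c) → ⨆ f ≤ c
    ⨅-lower    : {I : Set ℓ} (f : I → Carrier) → ∀ i → ⨅ f ≤ f i
    ⨅-greatest : {I : Set ℓ} (f : I → Carrier) → ∀ c → (∀ i → c ≤ f i) → c ≤ ⨅ f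

  open IsDistributiveLattice isDistributiveLattice public

module _ {ℓ} (L : CompleteDistributiveLattice ℓ) where
  open CompleteDistributiveLattice L

  -- A subset B of L, with greatest element top, whose joins and nonempty meets
  -- (the inhabitant of I being the argument preceding f) are those of L and in
  -- which complements are relative to top.  The empty join puts ⊥ in B.
  record IsCompleteBooleanSubalgebra {b} (B : Pred Carrier b) (top : Carrier)
         : Set (b Level.⊔ suc ℓ) where
    field
      respects     : ∀ {a b} → a ≈ b → a ∈ B → b ∈ B
      top-∈        : top ∈ B
      top-greatest : ∀ {a} → a ∈ B → a ≤ top
      ⨆-closed     : {I : Set ℓ} (f : I → Carrier) → (∀ i → f i ∈ B) → ⨆ f ∈ B
      ⨅-closed     : {I : Set ℓ} → I → (f : I → Carrier) → (∀ i → f i ∈ B) → ⨅ f ∈ B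
      complement   : ∀ {a} → a ∈ B →
                     ∃[ a′ ] (a′ ∈ B × a ⊓ a′ ≈ ⊥ × a ⊔ a′ ≈ top)

  -- An injective homomorphism of complete Boolean algebras from the powerset
  -- of X into L.  Its image is a complete Boolean subalgebra (see
  -- image-isCompleteBooleanSubalgebra).
  --
  -- Intuitionistically Pred X ℓ need not be Boolean: for inhabited X,
  -- injectivity and ∁-join entail excluded middle in Set ℓ.  The classical
  -- logic of the theory thus enters through this hypothesis.
  record IsBooleanEmbedding {X : Set ℓ} (h : Pred X ℓ → Carrier) : Set (suc ℓ) where
    field
      cong      : ∀ {p q} → p ≐ q → h p ≈ h q
      injective : ∀ {p q} → h p ≈ h q → p ≐ q
      ∅-homo    : h ∅ ≈ ⊥
      ⋃-homo    : {I : Set ℓ} (p : I → Pred X ℓ) → h (⋃ I p) ≈ ⨆ (h ∘ p)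
      ⋂-homo    : {I : Set ℓ} → I → (p : I → Pred X ℓ) → h (⋂ I p) ≈ ⨅ (h ∘ p)
      ∁-meet    : ∀ p → h p ⊓ h (∁ p) ≈ ⊥
      ∁-join    : ∀ p → h p ⊔ h (∁ p) ≈ h U

  Image : {X : Set ℓ} → (Pred X ℓ → Carrier) → Pred Carrier (suc ℓ)
  Image h c = ∃[ p ] h p ≈ c

  image-isCompleteBooleanSubalgebra :
    {X : Set ℓ} {h : Pred X ℓ → Carrier} → IsBooleanEmbedding h →
    IsCompleteBooleanSubalgebra (Image h) (h U)
  image-isCompleteBooleanSubalgebra {h = h} emb = record
    { respects     = λ { a≈b (p , hp≈a) → p , Eq.trans hp≈a a≈b }
    ; top-∈        = U , Eq.refl
    ; top-greatest = λ { (p , hp≈a) →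
        trans (reflexive (Eq.sym hp≈a))
              (trans (x≤x∨y (h p) (h (∁ p))) (reflexive (∁-join p))) }
    ; ⨆-closed     = λ f f∈ → ⋃ _ (proj₁ ∘ f∈) ,
        Eq.trans (⋃-homo (proj₁ ∘ f∈)) (antisym
          (⨆-least _ _ λ i → trans (reflexive (proj₂ (f∈ i))) (⨆-upper f i))
          (⨆-least _ _ λ i → trans (reflexive (Eq.sym (proj₂ (f∈ i)))) (⨆-upper _ i)))
    ; ⨅-closed     = λ i₀ f f∈ → ⋂ _ (proj₁ ∘ f∈) ,
        Eq.trans (⋂-homo i₀ (proj₁ ∘ f∈)) (antisym
          (⨅-greatest _ _ λ i → trans (⨅-lower _ i) (reflexive (proj₂ (f∈ i))))
          (⨅-greatest _ _ λ i → trans (⨅-lower f i) (reflexive (Eq.sym (proj₂ (f∈ i))))))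
    ; complement   = λ { {a} (p , hp≈a) → h (∁ p) , (∁ p , Eq.refl)
        , Eq.trans (antisym
            (∧-greatest (trans (x∧y≤x _ _) (reflexive (Eq.sym hp≈a))) (x∧y≤y _ _))
            (∧-greatest (trans (x∧y≤x _ _) (reflexive hp≈a)) (x∧y≤y _ _)))
            (∁-meet p)
        , Eq.trans (antisym
            (∨-least (trans (reflexive (Eq.sym hp≈a)) (x≤x∨y _ _)) (y≤x∨y _ _))
            (∨-least (trans (reflexive hp≈a) (x≤x∨y _ _)) (y≤x∨y _ _)))
            (∁-join p) }
    }
    where open IsBooleanEmbedding emb

  record IsLeastFixedPoint (f : Op₁ Carrier) (y : Carrier) : Set ℓ where
    field
      fixed : f y ≈ y
      least : ∀ z → f z ≈ z → y ≤ z

  record IsGreatestFixedPoint (f : Op₁ Carrier) (y : Carrier) : Set ℓ where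
    field
      fixed    : f y ≈ y
      greatest : ∀ z → f z ≈ z → z ≤ y

record CommandAlgebra {ℓ} (V S : Set ℓ) : Set (suc ℓ) where
  open States V S public
  field
    lattice : CompleteDistributiveLattice ℓ
  open CompleteDistributiveLattice lattice public renaming (Carrier to Command)

  infixr 8 _⨾_
  infixr 5 _⋒_
  infix  9 _^_ _^⋆ _^ω _^∞

  field
    _⨾_     : Op₂ Command
    nil     : Command
    _⋒_     : Op₂ Command
    _^⋆ _^ω : Op₁ Command

    ⨾-isMonoid : IsMonoid _≈_ _⨾_ nil
    ⨾-mono     : _⨾_ Preserves₂ _≤_ ⟶ _≤_ ⟶ _≤_

    ⋆-isLeastFixedPoint    : ∀ c → IsLeastFixedPoint lattice (λ y → nil ⊔ c ⨾ y) (c ^⋆)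
    ω-isGreatestFixedPoint : ∀ c → IsGreatestFixedPoint lattice (λ y → nil ⊔ c ⨾ y) (c ^ω)

  _^_ : Command → ℕ → Command
  c ^ i = fold nil (c ⨾_) i

  _^∞ : Op₁ Command
  c ^∞ = c ^ω ⨾ ⊥

  field
    ⋆-join   : ∀ c → c ^⋆ ≈ ⨆ {Lift ℓ ℕ} (λ i → c ^ lower i)
    ω-decomp : ∀ c → c ^ω ≈ c ^⋆ ⊔ c ^∞

    Atomic : Pred Command ℓ
    τ      : Pred State ℓ → Command
    π ε    : Rel State ℓ → Command

    τ-embedding : IsBooleanEmbedding lattice τ
    π-embedding : IsBooleanEmbedding lattice {State × State} (π ∘ curry)
    ε-embedding : IsBooleanEmbedding lattice {State × State} (ε ∘ curry)
    τ-U         : τ U ≈ nil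
    π-Atomic    : ∀ r → π r ∈ Atomic
    ε-Atomic    : ∀ r → ε r ∈ Atomic

  𝛑 : Command
  𝛑 = π (λ _ → U)

  𝛆 : Command
  𝛆 = ε (λ _ → U)

  𝛂 : Command
  𝛂 = 𝛑 ⊔ 𝛆

  chaos : Command
  chaos = 𝛂 ^ω

  guar : Rel State ℓ → Command
  guar g = (π g ⊔ 𝛆) ^ω

  demand : Rel State ℓ → Command
  demand r = (ε r ⊔ 𝛑) ^ω

  term : Command
  term = 𝛂 ^⋆ ⨾ 𝛆 ^ω

  idle : Command
  idle = term ⋒ guar idᵣ

  field
    -- Given that 𝛂, which is 𝛑 ⊔ 𝛆, is the greatest atomic step, 𝛑⊓𝛆≈⊥ says that
    -- 𝛑 and 𝛆 are complementary.
    Atomic-isSubalgebra : IsCompleteBooleanSubalgebra lattice Atomic 𝛂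
    𝛑⊓𝛆≈⊥               : 𝛑 ⊓ 𝛆 ≈ ⊥

    ⋒-isIdempotentCommutativeMonoid : IsIdempotentCommutativeMonoid _≈_ _⋒_ chaos
    ⋒-mono      : _⋒_ Preserves₂ _≤_ ⟶ _≤_ ⟶ _≤_
    Atomic-step : ∀ a → a ∈ Atomic → a ≈ a ⋒ (𝛂 ⨾ chaos)

    guar-⋒    : ∀ g₁ g₂ → guar g₁ ⋒ guar g₂ ≈ guar (g₁ ∩ g₂)
    guar-⨾    : ∀ g c d → guar g ⋒ (c ⨾ d) ≈ (guar g ⋒ c) ⨾ (guar g ⋒ d)
    idle-guar : ∀ g → IsReflexive g → idle ≈ idle ⋒ guar g

module _ {ℓ} {V S : Set ℓ} (A : CommandAlgebra V S) where
  open CommandAlgebra A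

  -- The axioms common to E, Efirst and Elast; Fᵣ is the operator on relations
  -- that corresponds to F.
  record IsLocalisation (F : V → Op₁ Command) (Fᵣ : V → Op₁ (Rel State ℓ))
         : Set (suc ℓ) where
    field
      cong      : ∀ x {c d} → c ≈ d → F x c ≈ F x d
      extensive : ∀ x c → c ≤ F x c
      ⊓-absorb  : ∀ x c d → F x (c ⊓ F x d) ≈ F x c ⊓ F x d
      commute   : ∀ x y c → F x (F y c) ≈ F y (F x c)
      ⨆-homo    : ∀ x {I : Set ℓ} (f : I → Command) → F x (⨆ f) ≈ ⨆ (F x ∘ f)
      on-τ      : ∀ x p → F x (τ p) ≈ τ (Eₛ x p)
      on-π      : ∀ x r → F x (π r) ≈ π (Fᵣ x r)
      on-ε      : ∀ x r → F x (ε r) ≈ ε (Fᵣ x r)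

  record Localisation : Set (suc ℓ) where
    field
      E Efirst Elast : V → Op₁ Command

      E-isLocalisation      : IsLocalisation E Eᵣ
      Efirst-isLocalisation : IsLocalisation Efirst Eᵣfirst
      Elast-isLocalisation  : IsLocalisation Elast Eᵣlast

      Efirst≤E     : ∀ x c → Efirst x c ≤ E x c
      Elast≤E      : ∀ x c → Elast x c ≤ E x c
      E-Efirst     : ∀ x y c → E x (Efirst y c) ≈ Efirst y (E x c)
      E-Elast      : ∀ x y c → E x (Elast y c) ≈ Elast y (E x c)
      Efirst-Elast : ∀ x y c → Efirst x (Elast y c) ≈ Elast y (Efirst x c)

      E-⨾-Efirst : ∀ x c d → E x (c ⨾ Efirst x d) ≈ E x c ⨾ E x d
      E-⨾-Elast  : ∀ x c d → E x (Elast x c ⨾ d) ≈ E x c ⨾ E x d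
      Efirst-⨾   : ∀ x c d → c ≈ c ⋒ (𝛂 ⨾ chaos) → Efirst x (c ⨾ d) ≈ Efirst x c ⨾ d
      Elast-⨾    : ∀ x c d → c ≈ c ⋒ (𝛂 ⨾ chaos) → Elast x (d ⨾ c) ≈ d ⨾ Elast x c

      E-⋒      : ∀ x c d → E x (c ⋒ E x d) ≈ E x c ⋒ E x d
      Efirst-⋒ : ∀ x c d → Efirst x (c ⋒ Efirst x d) ≈ Efirst x c ⋒ Efirst x d

      E-∞ : ∀ x a → a ∈ Atomic → E x a ≈ Elast x a → E x (a ^∞) ≈ (E x a) ^∞

    local var : V → Command → Command
    local x c = E x (demand (idVar x) ⋒ c) ⋒ guar (idVar x)
    var   x c = idle ⨾ local x c ⨾ idle

{-# OPTIONS --safe #-}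

-- Weak conjunction with guar g distributes over ⨾ and is absorbed by idle, so
-- only the local block matters.  There the point is that E x (guar g) ≈ guar g:
-- writing guar g as a ^ω ≈ a ^⋆ ⊔ a ^∞ with a = π g ⊔ 𝛆, both E x and Elast x fix
-- a, hence E x fixes every power of a, their join a ^⋆, and a ^∞.

module Submission where

open import Defs
open import Algebra.Structures using (IsIdempotentCommutativeMonoid; IsMonoid)
open import Data.Bool.Base using (Bool; true; false; if_then_else_)
open import Data.Nat.Base using (ℕ; zero; suc)
open import Data.Product.Base using (_,_; uncurry)
open import Data.Unit.Polymorphic.Base using (tt)
open import Function.Base using (_∘_)
open import Function.Bundles using (_↣_)
open import Level using (Lift; lift; lower)
open import Relation.Binary.Bundles using (Setoid)
open import Relation.Binary.Core using (Rel; _⇔_)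
open import Relation.Binary.Lattice.Bundles using (JoinSemilattice)
import Relation.Binary.Lattice.Properties.JoinSemilattice as JoinSemilatticeProperties
import Relation.Binary.PropositionalEquality.Core as ≡
import Relation.Binary.Reasoning.Setoid as ≈-Reasoning
open import Relation.Unary using (Pred; _∈_; _≐_)
open import Relation.Unary.Polymorphic using (U)

module _ {ℓ} {V S : Set ℓ} where
  open States V S

  Eₛ-U : ∀ x → Eₛ x U ≐ U {ℓ = ℓ}
  Eₛ-U x = (λ _ → tt) , λ {σ} _ → σ , tt , λ _ _ → ≡.refl

  -- Serves the summand `𝛆` of `guar g`, whose underlying relation is the universal one.
  Eᵣ-U : ∀ x → (λ _ → U {ℓ = ℓ}) ⇔ Eᵣ x (λ _ → U)
  Eᵣ-U x = (λ {σ} {σ′} _ → σ , (λ _ _ → ≡.refl) , σ′ , tt , λ _ _ → ≡.refl) , λ _ → tt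

  -- id(x̄) is reflexive and transitive.
  Eᵣ-fixed⇒Eᵣlast-fixed : ∀ x {r} → r ⇔ Eᵣ x r → r ⇔ Eᵣlast x r
  Eᵣ-fixed⇒Eᵣlast-fixed x (r⇒Er , Er⇒r) =
    (λ {_} {σ′} r → σ′ , r , λ _ _ → ≡.refl) ,
    λ { (_ , r , ρ~σ′) → let (υ , σ~υ , φ , r′ , φ~ρ) = r⇒Er r in
        Er⇒r (υ , σ~υ , φ , r′ , λ v v≢x → ≡.trans (φ~ρ v v≢x) (ρ~σ′ v v≢x)) }

module _ {ℓ} (L : CompleteDistributiveLattice ℓ) where
  open CompleteDistributiveLattice L

  joinSemilattice : JoinSemilattice ℓ ℓ ℓ
  joinSemilattice = record { isJoinSemilattice = isJoinSemilattice }

  open JoinSemilatticeProperties joinSemilattice public using () renaming (∨-cong to ⊔-cong)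

  ⨆-cong : {I : Set ℓ} {f g : I → Carrier} → (∀ i → f i ≈ g i) → ⨆ f ≈ ⨆ g
  ⨆-cong {f = f} {g} f≈g = antisym
    (⨆-least f _ λ i → trans (reflexive (f≈g i)) (⨆-upper g i))
    (⨆-least g _ λ i → trans (reflexive (Eq.sym (f≈g i))) (⨆-upper f i))

  -- The closure and homomorphism laws speak of joins of families; indexing by a lifted `Bool` makes
  -- a binary join one of these.
  pair : Carrier → Carrier → Lift ℓ Bool → Carrier
  pair a b i = if lower i then a else b

  ⨆-pair : ∀ a b → ⨆ (pair a b) ≈ a ⊔ b
  ⨆-pair a b = antisym
    (⨆-least _ _ λ { (lift true) → x≤x∨y a b ; (lift false) → y≤x∨y a b })
    (∨-least (⨆-upper (pair a b) (lift true)) (⨆-upper (pair a b) (lift false)))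

  ⊔-closed : ∀ {b} {B : Pred Carrier b} {top} → IsCompleteBooleanSubalgebra L B top →
             ∀ {c d} → c ∈ B → d ∈ B → c ⊔ d ∈ B
  ⊔-closed sub {c} {d} c∈ d∈ = respects (⨆-pair c d)
    (⨆-closed (pair c d) λ { (lift true) → c∈ ; (lift false) → d∈ })
    where open IsCompleteBooleanSubalgebra sub

  -- A fixed point of `f` is also one of the pointwise equal `g`, hence below the greatest. This is
  -- how `_^ω` is seen to respect `≈`.
  IsGreatestFixedPoint-mono : ∀ {f g y z} → (∀ c → f c ≈ g c) →
    IsGreatestFixedPoint L f y → IsGreatestFixedPoint L g z → y ≤ z
  IsGreatestFixedPoint-mono f≈g y-gfp z-gfp =
    greatest z-gfp _ (Eq.trans (Eq.sym (f≈g _)) (fixed y-gfp))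
    where open IsGreatestFixedPoint

module _ {ℓ} {V S : Set ℓ} (A : CommandAlgebra V S) where
  open CommandAlgebra A
  open IsMonoid ⨾-isMonoid using () renaming (∙-cong to ⨾-cong)

  commandSetoid : Setoid ℓ ℓ
  commandSetoid = record { isEquivalence = isEquivalence }

  ω-mono-≈ : ∀ {c d} → c ≈ d → c ^ω ≤ d ^ω
  ω-mono-≈ {c} {d} c≈d = IsGreatestFixedPoint-mono lattice
    (λ _ → ⊔-cong lattice Eq.refl (⨾-cong c≈d Eq.refl))
    (ω-isGreatestFixedPoint c) (ω-isGreatestFixedPoint d)

  ∞-cong : ∀ {c d} → c ≈ d → c ^∞ ≈ d ^∞
  ∞-cong c≈d = ⨾-cong (antisym (ω-mono-≈ c≈d) (ω-mono-≈ (Eq.sym c≈d))) Eq.refl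

  π-cong : ∀ {r s} → r ⇔ s → π r ≈ π s
  π-cong {r} {s} (r⇒s , s⇒r) =
    -- The embedding acts on sets of pairs, so both relations are uncurried and supplied explicitly.
    IsBooleanEmbedding.cong π-embedding {uncurry r} {uncurry s} (r⇒s , s⇒r)

  ε-cong : ∀ {r s} → r ⇔ s → ε r ≈ ε s
  ε-cong {r} {s} (r⇒s , s⇒r) =
    IsBooleanEmbedding.cong ε-embedding {uncurry r} {uncurry s} (r⇒s , s⇒r)

  module _ {F Fᵣ} (F-isLocalisation : IsLocalisation A F Fᵣ) where
    open IsLocalisation F-isLocalisation
    open ≈-Reasoning commandSetoid

    ⊔-homo : ∀ x c d → F x (c ⊔ d) ≈ F x c ⊔ F x d
    ⊔-homo x c d = begin
      F x (c ⊔ d)                      ≈⟨ cong x (⨆-pair lattice c d) ⟨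
      F x (⨆ (pair lattice c d))       ≈⟨ ⨆-homo x _ ⟩
      ⨆ (F x ∘ pair lattice c d)       ≈⟨ ⨆-cong lattice (λ { (lift true) → Eq.refl ; (lift false) → Eq.refl }) ⟩
      ⨆ (pair lattice (F x c) (F x d)) ≈⟨ ⨆-pair lattice (F x c) (F x d) ⟩
      F x c ⊔ F x d                    ∎

    -- `nil` is the test of the full state space, a set that `Eₛ x` leaves unchanged.
    nil-fixed : ∀ x → F x nil ≈ nil
    nil-fixed x = begin
      F x nil     ≈⟨ cong x τ-U ⟨
      F x (τ U)   ≈⟨ on-τ x U ⟩
      τ (Eₛ x U)  ≈⟨ IsBooleanEmbedding.cong τ-embedding (Eₛ-U x) ⟩
      τ U         ≈⟨ τ-U ⟩
      nil         ∎

    -- Generic in `F` because `π g ⊔ 𝛆` has to be fixed by both `E x` and `Elast x`.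
    π⊔ε-fixed : ∀ x {r s} → r ⇔ Fᵣ x r → s ⇔ Fᵣ x s → F x (π r ⊔ ε s) ≈ π r ⊔ ε s
    π⊔ε-fixed x {r} {s} r⇔Fr s⇔Fs = begin
      F x (π r ⊔ ε s)          ≈⟨ ⊔-homo x (π r) (ε s) ⟩
      F x (π r) ⊔ F x (ε s)    ≈⟨ ⊔-cong lattice (on-π x r) (on-ε x s) ⟩
      π (Fᵣ x r) ⊔ ε (Fᵣ x s)  ≈⟨ ⊔-cong lattice (π-cong r⇔Fr) (ε-cong s⇔Fs) ⟨
      π r ⊔ ε s                ∎

  module _ (L : Localisation A) where
    open Localisation L
    open ≈-Reasoning commandSetoid
    open IsIdempotentCommutativeMonoid ⋒-isIdempotentCommutativeMonoid using ()
      renaming (∙-cong to ⋒-cong; assoc to ⋒-assoc; comm to ⋒-comm)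
    module E = IsLocalisation E-isLocalisation

    module _ x {a} (Ea≈a : E x a ≈ a) (Elast-a≈a : Elast x a ≈ a) where

      ^-fixed : ∀ n → E x (a ^ n) ≈ a ^ n
      ^-fixed zero    = nil-fixed E-isLocalisation x
      ^-fixed (suc n) = begin
        -- `E-⨾-Elast` asks for a first factor of the form `Elast x c`; being fixed by `Elast x`,
        -- `a` can be put in that form.
        E x (a ⨾ a ^ n)          ≈⟨ E.cong x (⨾-cong Elast-a≈a Eq.refl) ⟨
        E x (Elast x a ⨾ a ^ n)  ≈⟨ E-⨾-Elast x a (a ^ n) ⟩
        E x a ⨾ E x (a ^ n)      ≈⟨ ⨾-cong Ea≈a (^-fixed n) ⟩
        a ⨾ a ^ n                ∎

      ⋆-fixed : E x (a ^⋆) ≈ a ^⋆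
      ⋆-fixed = begin
        E x (a ^⋆)                      ≈⟨ E.cong x (⋆-join a) ⟩
        E x (⨆ (λ i → a ^ lower i))     ≈⟨ E.⨆-homo x _ ⟩
        ⨆ (λ i → E x (a ^ lower i))     ≈⟨ ⨆-cong lattice (λ i → ^-fixed (lower i)) ⟩
        ⨆ (λ i → a ^ lower i)           ≈⟨ ⋆-join a ⟨
        a ^⋆                            ∎

      -- Preservation of joins settles `a ^⋆`. For `a ^∞` the axiom `E-∞` is used; its condition
      -- `E x a ≈ Elast x a` holds since both sides equal `a`.
      ω-fixed : a ∈ Atomic → E x (a ^ω) ≈ a ^ω
      ω-fixed a∈ = begin
        E x (a ^ω)               ≈⟨ E.cong x (ω-decomp a) ⟩
        E x (a ^⋆ ⊔ a ^∞)        ≈⟨ ⊔-homo E-isLocalisation x _ _ ⟩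
        E x (a ^⋆) ⊔ E x (a ^∞)  ≈⟨ ⊔-cong lattice ⋆-fixed (E-∞ x a a∈ (Eq.trans Ea≈a (Eq.sym Elast-a≈a))) ⟩
        a ^⋆ ⊔ (E x a) ^∞        ≈⟨ ⊔-cong lattice Eq.refl (∞-cong Ea≈a) ⟩
        a ^⋆ ⊔ a ^∞              ≈⟨ ω-decomp a ⟨
        a ^ω                     ∎

    guar-fixed : ∀ x {g} → g ⇔ Eᵣ x g → E x (guar g) ≈ guar g
    guar-fixed x {g} g⇔Eg = ω-fixed x
      (π⊔ε-fixed E-isLocalisation x g⇔Eg (Eᵣ-U x))
      -- For `g` and for the universal relation alike, invariance under `Eᵣlast x` follows from
      -- invariance under `Eᵣ x`.
      (π⊔ε-fixed Elast-isLocalisation x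
        (Eᵣ-fixed⇒Eᵣlast-fixed x g⇔Eg) (Eᵣ-fixed⇒Eᵣlast-fixed x (Eᵣ-U x)))
      (⊔-closed lattice Atomic-isSubalgebra (π-Atomic g) (ε-Atomic _))

    -- `E-⋒` moves `E x d` under `E x`, and fixedness lets `d` stand for `E x d` before and after
    -- the move.
    local-⋒-fixed : ∀ x c {d} → E x d ≈ d → local x c ⋒ d ≈ local x (c ⋒ d)
    local-⋒-fixed x c {d} Ed≈d = begin
      (E x (dem ⋒ c) ⋒ gx) ⋒ d     ≈⟨ ⋒-assoc _ _ _ ⟩
      -- `d` has to pass the outer guarantee `gx` to reach the part under `E x`.
      E x (dem ⋒ c) ⋒ (gx ⋒ d)     ≈⟨ ⋒-cong Eq.refl (⋒-comm gx d) ⟩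
      E x (dem ⋒ c) ⋒ (d ⋒ gx)     ≈⟨ ⋒-assoc _ _ _ ⟨
      (E x (dem ⋒ c) ⋒ d) ⋒ gx     ≈⟨ ⋒-cong E-absorbs-d Eq.refl ⟩
      E x (dem ⋒ (c ⋒ d)) ⋒ gx     ∎
      where
      dem = demand (idVar x)
      gx  = guar (idVar x)
      E-absorbs-d : E x (dem ⋒ c) ⋒ d ≈ E x (dem ⋒ (c ⋒ d))
      E-absorbs-d = begin
        E x (dem ⋒ c) ⋒ d        ≈⟨ ⋒-cong Eq.refl Ed≈d ⟨
        E x (dem ⋒ c) ⋒ E x d    ≈⟨ E-⋒ x _ d ⟨
        E x ((dem ⋒ c) ⋒ E x d)  ≈⟨ E.cong x (⋒-cong Eq.refl Ed≈d) ⟩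
        E x ((dem ⋒ c) ⋒ d)      ≈⟨ E.cong x (⋒-assoc dem c d) ⟩
        E x (dem ⋒ (c ⋒ d))      ∎

    var-⋒-guar : ∀ x c g → IsReflexive g → g ⇔ Eᵣ x g →
                 var x c ⋒ guar g ≈ var x (c ⋒ guar g)
    var-⋒-guar x c g g-refl g⇔Eg = begin
      (idle ⨾ local x c ⨾ idle) ⋒ guar g                            ≈⟨ ⋒-comm _ _ ⟩
      -- `⨾` associates to the right, so two uses of `guar-⨾` give each of the three factors its own
      -- copy of `guar g`.
      guar g ⋒ (idle ⨾ local x c ⨾ idle)                            ≈⟨ guar-⨾ g _ _ ⟩
      (guar g ⋒ idle) ⨾ (guar g ⋒ (local x c ⨾ idle))               ≈⟨ ⨾-cong Eq.refl (guar-⨾ g _ _) ⟩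
      (guar g ⋒ idle) ⨾ (guar g ⋒ local x c) ⨾ (guar g ⋒ idle)      ≈⟨ ⨾-cong guar⋒idle (⨾-cong guar⋒local guar⋒idle) ⟩
      idle ⨾ local x (c ⋒ guar g) ⨾ idle                            ∎
      where
      -- Reflexivity of `g` enters here: idling already guarantees every reflexive relation.
      guar⋒idle : guar g ⋒ idle ≈ idle
      guar⋒idle = Eq.trans (⋒-comm _ _) (Eq.sym (idle-guar g g-refl))
      -- Invariance of `g` under `Eᵣ x` enters here, making `guar g` a fixed point of `E x`.
      guar⋒local : guar g ⋒ local x c ≈ local x (c ⋒ guar g)
      guar⋒local = Eq.trans (⋒-comm _ _) (local-⋒-fixed x c (guar-fixed x g⇔Eg))

-- Countability of `V` is expressed by an injection into `ℕ`, and equality of relations by mutual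
-- inclusion `⇔`.
mainTheorem5 :
    ∀ {ℓ} (V S : Set ℓ) → V ↣ ℕ →
    (A : CommandAlgebra V S) (L : Localisation A) →
    let open CommandAlgebra A
        open Localisation L
    in (x : V) (c : Command) (g : Rel State ℓ) →
       IsReflexive g → g ⇔ Eᵣ x g →
       var x c ⋒ guar g ≈ var x (c ⋒ guar g)
mainTheorem5 V S _ A L = var-⋒-guar A L
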